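{- Let $G$ be a connected (simple) cubic graph of order $n$ that has a spanning $2$-factor consisting of triangles (i.e., $V(G)$ can be partitioned into sets each inducing a subgraph containing a triangle $K_3$ as spanning subgraph, so that these triangles cover every vertex exactly once). Then $F_t(G) \le \frac{n}{2}$, with equality if and only if $G$ is the prism $C_3 \,\Box\, K_2$.
   Context: Forcing process: given a graph $G$ and a set $S \subseteq V(G)$ of initially colored vertices (all others non-colored), at each step, if a colored vertex has exactly one non-colored neighbor, that neighbor becomes colored. $S$ is a forcing set (zero forcing set) if iterating this process eventually colors all of $V(G)$. A total forcing set is a forcing set $S$ such that the induced subgraph $G[S]$ has no isolated vertex. $F_t(G)$ denotes the minimum cardinality of a total forcing set of $G$. A $2$-factor is a spanning $2$-regular subgraph. The prism $C_3 \,\Box\, K_2$ is the Cartesian product of a triangle and an edge (two disjoint triangles joined by a perfect matching). -}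

module Defs where

open import Data.Nat using (ℕ; _≡ᵇ_; _/_; _%_)
open import Data.Bool using (Bool; true; false; not; _∧_; _∨_)
open import Data.Fin using (Fin; toℕ)
open import Data.Fin.Subset using (Subset; _∈_; ∣_∣)
open import Data.Vec using (tabulate)
open import Data.List using (List; []; _∷_; concatMap; allFin)
open import Data.List.Relation.Binary.Permutation.Propositional using (_↭_)
open import Data.Product using (Σ; _×_; _,_)
open import Function.Bundles using (_⤖_; Bijection)
open import Relation.Binary.PropositionalEquality using (_≡_)
open import Relation.Nullary using (¬_)

AdjFn : ℕ → Set
AdjFn n = Fin n → Fin n → Bool

Adj : ∀ {n} → AdjFn n → Fin n → Fin n → Set
Adj G u v = G u v ≡ true

Simple : ∀ {n} → AdjFn n → Set
Simple {n} G = (∀ u v → G u v ≡ G v u) × (∀ v → G v v ≡ false)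

N : ∀ {n} → AdjFn n → Fin n → Subset n
N G v = tabulate (G v)

degree : ∀ {n} → AdjFn n → Fin n → ℕ
degree G v = ∣ N G v ∣

Cubic : ∀ {n} → AdjFn n → Set
Cubic G = ∀ v → degree G v ≡ 3

data Reach {n} (G : AdjFn n) : Fin n → Fin n → Set where
  here : ∀ {v} → Reach G v v
  step : ∀ {u w v} → Adj G u w → Reach G w v → Reach G u v

Connected : ∀ {n} → AdjFn n → Set
Connected G = ∀ u v → Reach G u v

IsTriangle : ∀ {n} → AdjFn n → Fin n × Fin n × Fin n → Set
IsTriangle G (a , b , c) = Adj G a b × Adj G b c × Adj G a c

triVerts : ∀ {n} → Fin n × Fin n × Fin n → List (Fin n)
triVerts (a , b , c) = a ∷ b ∷ c ∷ []

data AllTriangles {n} (G : AdjFn n) : List (Fin n × Fin n × Fin n) → Set where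
  []  : AllTriangles G []
  _∷_ : ∀ {t ts} → IsTriangle G t → AllTriangles G ts → AllTriangles G (t ∷ ts)

-- a 2-factor consisting of triangles: a list of triangles of G covering
-- every vertex exactly once (the concatenated vertex list is a permutation
-- of the list of all vertices)
HasTriangleFactor : ∀ {n} → AdjFn n → Set
HasTriangleFactor {n} G =
  Σ (List (Fin n × Fin n × Fin n)) λ ts →
    AllTriangles G ts × (concatMap triVerts ts ↭ allFin n)

-- forcing process: the set of vertices eventually coloured from S.
-- v gets coloured if some coloured u is adjacent to v and every other
-- neighbour of u is coloured (colour-change rule).
data Colored {n} (G : AdjFn n) (S : Subset n) : Fin n → Set where
  init  : ∀ {v} → v ∈ S → Colored G S v
  force : ∀ {u v} → Colored G S u → Adj G u v →
          (∀ w → Adj G u w → ¬ (w ≡ v) → Colored G S w) →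
          Colored G S v

IsForcingSet : ∀ {n} → AdjFn n → Subset n → Set
IsForcingSet G S = ∀ v → Colored G S v

IsTotal : ∀ {n} → AdjFn n → Subset n → Set
IsTotal G S = ∀ v → v ∈ S → Σ _ λ u → u ∈ S × Adj G v u

IsTotalForcingSet : ∀ {n} → AdjFn n → Subset n → Set
IsTotalForcingSet G S = IsForcingSet G S × IsTotal G S

IsFt : ∀ {n} → AdjFn n → ℕ → Set
IsFt {n} G k =
  (Σ (Subset n) λ S → IsTotalForcingSet G S × ∣ S ∣ ≡ k) ×
  (∀ S → IsTotalForcingSet G S → k Data.Nat.≤ ∣ S ∣)

-- the prism C3 □ K2 on Fin 6: triangles {0,1,2}, {3,4,5}, matching i ~ i+3
prism : AdjFn 6
prism u v =
  not (toℕ u ≡ᵇ toℕ v) ∧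
  ((toℕ u / 3 ≡ᵇ toℕ v / 3) ∨ (toℕ u % 3 ≡ᵇ toℕ v % 3))

Isomorphic : ∀ {n m} → AdjFn n → AdjFn m → Set
Isomorphic {n} {m} G H =
  Σ (Fin n ⤖ Fin m) λ f →
    ∀ u v → G u v ≡ H (Bijection.to f u) (Bijection.to f v)

{-# OPTIONS --safe #-}
module Submission where

-- Let ρ rotate the triangles and σ follow the matching edges.  When every seed s has σ s
-- coloured, the coloured set is closed under σ.  As long as it is not everything, some triangle
-- has exactly one coloured vertex, and adding its other two vertices as seeds colours at least
-- those two and their σ-images.  A single triangle colours at least six vertices, so extending
-- it in this way gives F_t ≤ n / 2, and any seed set S colouring more than 2 |S| vertices gives
-- F_t < n / 2.
--
-- Assume equality, and let T be a triangle.  T colours only T ∪ σ T.  If two vertices of σ T lie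
-- in one triangle, then so does the third, and G is the prism.  Otherwise no two triangles are
-- joined by two edges; take x ∈ T and the other vertices v , w of the triangle of σ x.  The seeds
-- T , v , w colour exactly ten vertices, which cannot meet the triangle of y = σ v in a second
-- vertex, and then the six seeds T , v , y , ρ y colour at least fourteen.
--
-- The lower bound for the prism is |S| ≥ 3 for every forcing set S of a cubic graph.

open import Defs
open import Data.Nat using (ℕ; suc; _+_; _*_; _≤_; _<_; _<?_; s≤s)
open import Data.Nat.Properties
  using (≤-trans; ≤-refl; ≤-reflexive; ≤-antisym; n≤1+n; +-suc; +-comm;
         +-assoc; +-identityʳ; +-monoˡ-≤; +-monoʳ-≤; +-cancelˡ-≤; +-cancelʳ-≤; *-distribˡ-+; *-monoʳ-≤;
         <-irrefl; <⇒≱; ≮⇒≥; module ≤-Reasoning)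
open import Data.Nat.Induction using (<-wellFounded)
open import Data.Bool using (Bool; true; false)
open import Data.Bool.Properties using () renaming (_≟_ to _≟ᵇ_)
open import Data.Fin using (Fin; zero; suc)
open import Data.Fin.Patterns
open import Data.Fin.Properties using (_≟_; any?; all?; injective⇒≤)
open import Data.Fin.Subset using (Subset; inside; outside; _∈_; _∉_; _⊆_; _⊂_; _⊃_; _∪_; ⁅_⁆; ∣_∣)
  renaming (⊥ to ∅)
open import Data.Fin.Subset.Properties
  using (_∈?_; x∈⁅x⁆; x∈⁅y⁆⇒x≡y; x∈p∪q⁺; x∈p∪q⁻; p⊆p∪q; ∉⊥; ∣⊥∣≡0; ∣p∣≤n;
         p⊆q⇒∣p∣≤∣q∣; p⊂q⇒∣p∣<∣q∣; ∪-identityˡ; anySubset?)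
open import Data.Fin.Subset.Induction using (⊃-wellFounded)
open import Data.List using (List; []; _∷_; length; concatMap; allFin; lookup)
open import Data.List.Membership.Propositional using () renaming (_∈_ to _∈ₗ_; _∉_ to _∉ₗ_)
open import Data.List.Membership.Propositional.Properties using (∈-allFin; ∈-lookup)
import Data.List.Membership.DecPropositional as DecMembership
open import Data.List.Relation.Unary.All as All using (All; []; _∷_)
open import Data.List.Relation.Unary.All.Properties using (¬Any⇒All¬; All¬⇒¬Any)
open import Data.List.Relation.Unary.Any using (here; there)
open import Data.List.Relation.Unary.Unique.Propositional using (Unique; []; _∷_)
open import Data.List.Relation.Unary.Unique.Propositional.Properties using (allFin⁺)
open import Data.List.Relation.Binary.Permutation.Propositional using (_↭_; ↭-sym; ↭⇒↭ₛ)
open import Data.List.Relation.Binary.Permutation.Propositional.Properties using (∈-resp-↭)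
open import Data.List.Relation.Binary.Permutation.Setoid.Properties using (Unique-resp-↭)
open import Data.Product using (Σ; ∃; _×_; _,_; proj₁; proj₂)
open import Data.Sum using (_⊎_; inj₁; inj₂; [_,_]′)
open import Data.Vec using (_∷_)
open import Data.Vec.Properties using (lookup∘tabulate; []=⇒lookup; lookup⇒[]=)
open import Function using (_∘_; id)
open import Function.Bundles using (_⇔_; mk⇔; mk⤖; Bijection)
open import Function.Definitions using (Injective)
open import Induction.WellFounded using (Acc; acc)
open import Relation.Binary.PropositionalEquality
  using (_≡_; _≢_; refl; sym; trans; cong; subst; subst₂; setoid; ≢-sym)
open import Relation.Nullary using (¬_; Dec; yes; no; contradiction)
open import Relation.Nullary.Decidable using (_×-dec_; _→-dec_; _⊎-dec_; ¬?; decidable-stable; map′; from-yes)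
open import Relation.Unary using (Decidable)

private
  variable
    n : ℕ

-- Cardinalities of finite subsets

-- The vertices of `xs` are added to `C` one at a time, each insertion being strict. All lower
-- bounds on coloured sets come from exhibiting such a list.
∣C∣+length≤∣D∣ : {C D : Subset n} (xs : List (Fin n)) → Unique xs →
                 C ⊆ D → All (_∈ D) xs → All (_∉ C) xs → ∣ C ∣ + length xs ≤ ∣ D ∣
∣C∣+length≤∣D∣ {C = C} [] _ C⊆D _ _ =
  ≤-trans (≤-reflexive (+-identityʳ ∣ C ∣)) (p⊆q⇒∣p∣≤∣q∣ C⊆D)
∣C∣+length≤∣D∣ {C = C} {D} (x ∷ xs) (x∉xs ∷ u) C⊆D (x∈D ∷ xs∈D) (x∉C ∷ xs∉C) = begin
  ∣ C ∣ + suc (length xs)        ≡⟨ +-suc ∣ C ∣ (length xs) ⟩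
  suc ∣ C ∣ + length xs          ≤⟨ +-monoˡ-≤ (length xs) (p⊂q⇒∣p∣<∣q∣ C⊂C+x) ⟩
  ∣ C ∪ ⁅ x ⁆ ∣ + length xs      ≤⟨ ∣C∣+length≤∣D∣ xs u C+x⊆D xs∈D (All.zipWith new (x∉xs , xs∉C)) ⟩
  ∣ D ∣                          ∎
  where
  open ≤-Reasoning
  C⊂C+x : C ⊂ C ∪ ⁅ x ⁆
  C⊂C+x = p⊆p∪q ⁅ x ⁆ , x , x∈p∪q⁺ {p = C} (inj₂ (x∈⁅x⁆ x)) , x∉C
  C+x⊆D : C ∪ ⁅ x ⁆ ⊆ D
  C+x⊆D y∈ = [ C⊆D , (λ y∈⁅x⁆ → subst (_∈ D) (sym (x∈⁅y⁆⇒x≡y x y∈⁅x⁆)) x∈D) ]′ (x∈p∪q⁻ C ⁅ x ⁆ y∈)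
  new : ∀ {y} → x ≢ y × y ∉ C → y ∉ C ∪ ⁅ x ⁆
  new (x≢y , y∉C) y∈ =
    [ y∉C , (λ y∈⁅x⁆ → x≢y (sym (x∈⁅y⁆⇒x≡y x y∈⁅x⁆))) ]′ (x∈p∪q⁻ C ⁅ x ⁆ y∈)

length≤∣D∣ : {D : Subset n} (xs : List (Fin n)) → Unique xs → All (_∈ D) xs → length xs ≤ ∣ D ∣
length≤∣D∣ {n} {D} xs u xs∈D =
  subst (λ k → k + length xs ≤ ∣ D ∣) (∣⊥∣≡0 n)
        (∣C∣+length≤∣D∣ xs u (λ x∈∅ → contradiction x∈∅ ∉⊥) xs∈D (All.map (λ _ → ∉⊥) xs∈D))

∣⁅x⁆∪p∣≤1+∣p∣ : (x : Fin n) (p : Subset n) → ∣ ⁅ x ⁆ ∪ p ∣ ≤ suc ∣ p ∣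
∣⁅x⁆∪p∣≤1+∣p∣ zero    (outside ∷ p) rewrite ∪-identityˡ p = ≤-refl
∣⁅x⁆∪p∣≤1+∣p∣ zero    (inside  ∷ p) rewrite ∪-identityˡ p = n≤1+n _
∣⁅x⁆∪p∣≤1+∣p∣ (suc x) (outside ∷ p) = ∣⁅x⁆∪p∣≤1+∣p∣ x p
∣⁅x⁆∪p∣≤1+∣p∣ (suc x) (inside  ∷ p) = s≤s (∣⁅x⁆∪p∣≤1+∣p∣ x p)

fromList : List (Fin n) → Subset n
fromList []       = ∅
fromList (x ∷ xs) = ⁅ x ⁆ ∪ fromList xs

∈-fromList⁺ : {x : Fin n} (xs : List (Fin n)) → x ∈ₗ xs → x ∈ fromList xs
∈-fromList⁺ (_ ∷ _)  (here refl) = x∈p∪q⁺ (inj₁ (x∈⁅x⁆ _))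
∈-fromList⁺ (_ ∷ xs) (there x∈)  = x∈p∪q⁺ (inj₂ (∈-fromList⁺ xs x∈))

∈-fromList⁻ : {x : Fin n} (xs : List (Fin n)) → x ∈ fromList xs → x ∈ₗ xs
∈-fromList⁻ []       x∈ = contradiction x∈ ∉⊥
∈-fromList⁻ (y ∷ ys) x∈ =
  [ here ∘ x∈⁅y⁆⇒x≡y y , there ∘ ∈-fromList⁻ ys ]′ (x∈p∪q⁻ ⁅ y ⁆ (fromList ys) x∈)

∣fromList∣≤length : (xs : List (Fin n)) → ∣ fromList xs ∣ ≤ length xs
∣fromList∣≤length {n} []       = ≤-reflexive (∣⊥∣≡0 n)
∣fromList∣≤length     (x ∷ xs) =
  ≤-trans (∣⁅x⁆∪p∣≤1+∣p∣ x (fromList xs)) (s≤s (∣fromList∣≤length xs))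

-- `IsFt` asks for an attained minimum. Starting from a witness, the finite search for a smaller one
-- is repeated until it fails.
smallest : {P : Subset n → Set} → Decidable P → ∃ P →
           Σ ℕ λ k → (Σ (Subset n) λ S → P S × ∣ S ∣ ≡ k) × (∀ S → P S → k ≤ ∣ S ∣)
smallest {n} {P} P? (S , pS) = go S pS (<-wellFounded ∣ S ∣)
  where
  go : ∀ S → P S → Acc _<_ ∣ S ∣ →
       Σ ℕ λ k → (Σ (Subset n) λ T → P T × ∣ T ∣ ≡ k) × (∀ T → P T → k ≤ ∣ T ∣)
  go S pS (acc rec) with anySubset? (λ T → P? T ×-dec (∣ T ∣ <? ∣ S ∣))
  ... | yes (T , pT , T<S) = go T pT (rec T<S)
  ... | no  none           = ∣ S ∣ , (S , pS , refl) , λ T pT → ≮⇒≥ (λ T<S → none (T , pT , T<S))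

-- The forcing process and neighbourhoods in cubic graphs

module _ (G : AdjFn n) where

  -- The seeds in `S` need only be coloured from `T`, not belong to it, so seed sets can be compared
  -- when one forces the seeds of the other.
  Colored-mono : ∀ {S T} → (∀ {v} → v ∈ S → Colored G T v) → ∀ {v} → Colored G S v → Colored G T v
  Colored-mono S⊆T (init v∈S)       = S⊆T v∈S
  Colored-mono S⊆T (force cu uv cw) =
    force (Colored-mono S⊆T cu) uv (λ w uw w≢v → Colored-mono S⊆T (cw w uw w≢v))

  adj? : ∀ u v → Dec (Adj G u v)
  adj? u v = G u v ≟ᵇ true

  Forces : Subset n → Fin n → Fin n → Set
  Forces C u v = u ∈ C × v ∉ C × Adj G u v × (∀ w → Adj G u w → ¬ (w ≡ v) → w ∈ C)

  forces? : ∀ C u v → Dec (Forces C u v)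
  forces? C u v = (u ∈? C) ×-dec (¬? (v ∈? C) ×-dec (adj? u v ×-dec
    all? (λ w → adj? u w →-dec (¬? (w ≟ v) →-dec (w ∈? C)))))

  -- Forces are carried out one by one; each enlarges `C`, so the process stops. A stuck set
  -- containing `S` contains every coloured vertex, by induction on the derivation. This makes
  -- `Colored` decidable and gives the coloured set a cardinality.
  closure : ∀ S → Σ (Subset n) λ C →
            (∀ {v} → v ∈ C → Colored G S v) × (∀ {v} → Colored G S v → v ∈ C)
  closure S = go S (⊃-wellFounded S) id init
    where
    go : ∀ C → Acc _⊃_ C → S ⊆ C → (∀ {v} → v ∈ C → Colored G S v) → Σ (Subset n) λ D →
         (∀ {v} → v ∈ D → Colored G S v) × (∀ {v} → Colored G S v → v ∈ D)
    go C (acc rec) S⊆C sound with any? (λ u → any? (λ v → forces? C u v))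
    ... | yes (u , v , u∈C , v∉C , uv , others) =
          go (C ∪ ⁅ v ⁆) (rec (p⊆p∪q ⁅ v ⁆ , v , x∈p∪q⁺ {p = C} (inj₂ (x∈⁅x⁆ v)) , v∉C))
             (λ x∈S → p⊆p∪q ⁅ v ⁆ (S⊆C x∈S)) sound′
      where
      sound′ : ∀ {x} → x ∈ C ∪ ⁅ v ⁆ → Colored G S x
      sound′ {x} x∈ with x∈p∪q⁻ C ⁅ v ⁆ x∈
      ... | inj₁ x∈C = sound x∈C
      ... | inj₂ x∈v rewrite x∈⁅y⁆⇒x≡y v x∈v =
            force (sound u∈C) uv (λ w uw w≢v → sound (others w uw w≢v))
    ... | no stuck = C , sound , complete
      where
      complete : ∀ {v} → Colored G S v → v ∈ C
      complete (init v∈S) = S⊆C v∈S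
      complete {v} (force {u} cu uv cw) with v ∈? C
      ... | yes v∈C = v∈C
      ... | no  v∉C = contradiction
            (u , v , complete cu , v∉C , uv , λ w uw w≢v → complete (cw w uw w≢v)) stuck

  colored? : ∀ S v → Dec (Colored G S v)
  colored? S v with closure S
  ... | C , sound , complete = map′ sound complete (v ∈? C)

  isTotalForcingSet? : Decidable (IsTotalForcingSet G)
  isTotalForcingSet? S = all? (colored? S) ×-dec
    all? (λ v → (v ∈? S) →-dec any? (λ u → (u ∈? S) ×-dec adj? v u))

  Adj⇒∈N : ∀ {u v} → Adj G u v → v ∈ N G u
  Adj⇒∈N {u} {v} uv = lookup⇒[]= v (N G u) (trans (lookup∘tabulate (G u) v) uv)

  ∈N⇒Adj : ∀ {u v} → v ∈ N G u → Adj G u v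
  ∈N⇒Adj {u} {v} v∈N = trans (sym (lookup∘tabulate (G u) v)) ([]=⇒lookup v∈N)

  Reach-exit : ∀ {P : Fin n → Set} → Decidable P → ∀ {u v} → Reach G u v → P u → ¬ P v →
               Σ (Fin n) λ a → Σ (Fin n) λ b → P a × ¬ P b × Adj G a b
  Reach-exit P? here pu ¬pv = contradiction pu ¬pv
  Reach-exit P? (step {u} {w} uw r) pu ¬pv with P? w
  ... | yes pw = Reach-exit P? r pw ¬pv
  ... | no ¬pw = u , w , pu , ¬pw , uw

  module _ (simple : Simple G) where

    Adj-sym : ∀ {u v} → Adj G u v → Adj G v u
    Adj-sym {u} {v} uv = trans (proj₁ simple v u) uv

    Adj⇒≢ : ∀ {u v} → Adj G u v → u ≢ v
    Adj⇒≢ {u} uu refl with trans (sym uu) (proj₂ simple u)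
    ... | ()

  module _ (cubic : Cubic G) where

    all-neighbours : ∀ {v p q r} → Adj G v p → Adj G v q → Adj G v r → p ≢ q → p ≢ r → q ≢ r →
                     ∀ {w} → Adj G v w → w ≡ p ⊎ w ≡ q ⊎ w ≡ r
    all-neighbours {v} {p} {q} {r} vp vq vr p≢q p≢r q≢r {w} vw with w ≟ p | w ≟ q | w ≟ r
    ... | yes e | _     | _     = inj₁ e
    ... | no  _ | yes e | _     = inj₂ (inj₁ e)
    ... | no  _ | no  _ | yes e = inj₂ (inj₂ e)
    ... | no  a | no  b | no  c = contradiction
          (subst (4 ≤_) (cubic v)
            (length≤∣D∣ (w ∷ p ∷ q ∷ r ∷ [])
              ((a ∷ b ∷ c ∷ []) ∷ (p≢q ∷ p≢r ∷ []) ∷ (q≢r ∷ []) ∷ [] ∷ [])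
              (Adj⇒∈N vw ∷ Adj⇒∈N vp ∷ Adj⇒∈N vq ∷ Adj⇒∈N vr ∷ [])))
          λ { (s≤s (s≤s (s≤s ()))) }

    third-neighbour : ∀ v p q → Σ (Fin n) λ r → Adj G v r × r ≢ p × r ≢ q
    third-neighbour v p q with any? (λ r → adj? v r ×-dec (¬? (r ≟ p) ×-dec ¬? (r ≟ q)))
    ... | yes found = found
    ... | no  none  = contradiction
          (subst (_≤ 2) (cubic v)
            (≤-trans (p⊆q⇒∣p∣≤∣q∣ N⊆) (∣fromList∣≤length (p ∷ q ∷ []))))
          λ { (s≤s (s≤s ())) }
      where
      N⊆ : N G v ⊆ fromList (p ∷ q ∷ [])
      N⊆ {r} r∈N with r ≟ p | r ≟ q
      ... | yes e | _     = ∈-fromList⁺ (p ∷ q ∷ []) (here e)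
      ... | no  _ | yes e = ∈-fromList⁺ (p ∷ q ∷ []) (there (here e))
      ... | no  a | no  b = contradiction (r , ∈N⇒Adj r∈N , a , b) none

-- The triangle factor as a rotation `ρ` and a matching `σ`

-- `Rot ts u v w` places `u , v , w` in the cyclic order of a listed triangle. Fixing an orientation
-- is what makes the 2-factor a function of order three.
data Rot {n} : List (Fin n × Fin n × Fin n) → Fin n → Fin n → Fin n → Set where
  abc   : ∀ {a b c ts} → Rot ((a , b , c) ∷ ts) a b c
  bca   : ∀ {a b c ts} → Rot ((a , b , c) ∷ ts) b c a
  cab   : ∀ {a b c ts} → Rot ((a , b , c) ∷ ts) c a b
  later : ∀ {t ts u v w} → Rot ts u v w → Rot (t ∷ ts) u v w

module _ {n : ℕ} where

  private
    variable
      ts      : List (Fin n × Fin n × Fin n)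
      u v w v′ w′ : Fin n

  rotate : Rot ts u v w → Rot ts v w u
  rotate abc       = bca
  rotate bca       = cab
  rotate cab       = abc
  rotate (later r) = later (rotate r)

  Rot⇒∈ : Rot ts u v w → u ∈ₗ concatMap triVerts ts
  Rot⇒∈ abc       = here refl
  Rot⇒∈ bca       = there (here refl)
  Rot⇒∈ cab       = there (there (here refl))
  Rot⇒∈ (later r) = there (there (there (Rot⇒∈ r)))

  ∈⇒Rot : ∀ ts → u ∈ₗ concatMap triVerts ts → Σ (Fin n) λ v → Σ (Fin n) λ w → Rot ts u v w
  ∈⇒Rot (_ ∷ _) (here refl)                 = _ , _ , abc
  ∈⇒Rot (_ ∷ _) (there (here refl))         = _ , _ , bca
  ∈⇒Rot (_ ∷ _) (there (there (here refl))) = _ , _ , cab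
  ∈⇒Rot (_ ∷ ts) (there (there (there u∈)))  with ∈⇒Rot ts u∈
  ... | v , w , r = v , w , later r

  -- Two different positions for `u` would repeat it in the concatenated vertex list. Hence the
  -- successor of `u` does not depend on how its triangle was found.
  Rot-functional : Unique (concatMap triVerts ts) → Rot ts u v w → Rot ts u v′ w′ → v ≡ v′
  Rot-functional _ abc abc = refl
  Rot-functional _ bca bca = refl
  Rot-functional _ cab cab = refl
  Rot-functional ((a≢a ∷ _) ∷ _)     abc bca = contradiction refl a≢a
  Rot-functional ((_ ∷ a≢a ∷ _) ∷ _) abc cab = contradiction refl a≢a
  Rot-functional ((a≢a ∷ _) ∷ _)     bca abc = contradiction refl a≢a
  Rot-functional (_ ∷ (a≢a ∷ _) ∷ _) bca cab = contradiction refl a≢a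
  Rot-functional ((_ ∷ a≢a ∷ _) ∷ _) cab abc = contradiction refl a≢a
  Rot-functional (_ ∷ (a≢a ∷ _) ∷ _) cab bca = contradiction refl a≢a
  Rot-functional ((_ ∷ _ ∷ a∉) ∷ _)  abc (later r) = contradiction (Rot⇒∈ r) (All¬⇒¬Any a∉)
  Rot-functional (_ ∷ (_ ∷ b∉) ∷ _)  bca (later r) = contradiction (Rot⇒∈ r) (All¬⇒¬Any b∉)
  Rot-functional (_ ∷ _ ∷ c∉ ∷ _)    cab (later r) = contradiction (Rot⇒∈ r) (All¬⇒¬Any c∉)
  Rot-functional ((_ ∷ _ ∷ a∉) ∷ _)  (later r) abc = contradiction (Rot⇒∈ r) (All¬⇒¬Any a∉)
  Rot-functional (_ ∷ (_ ∷ b∉) ∷ _)  (later r) bca = contradiction (Rot⇒∈ r) (All¬⇒¬Any b∉)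
  Rot-functional (_ ∷ _ ∷ c∉ ∷ _)    (later r) cab = contradiction (Rot⇒∈ r) (All¬⇒¬Any c∉)
  Rot-functional (_ ∷ _ ∷ _ ∷ uniq)  (later r) (later r′) = Rot-functional uniq r r′

  Rot⇒Adj : {G : AdjFn n} → Simple G → AllTriangles G ts → Rot ts u v w → Adj G u v
  Rot⇒Adj s ((ab , _  , _)  ∷ _) abc = ab
  Rot⇒Adj s ((_  , bc , _)  ∷ _) bca = bc
  Rot⇒Adj {G = G} s ((_  , _  , ac) ∷ _) cab = Adj-sym G s ac
  Rot⇒Adj s (_ ∷ △s) (later r) = Rot⇒Adj s △s r

-- ρ rotates each triangle of the 2-factor, σ follows the remaining edge at each vertex.
record Frame (G : AdjFn n) : Set where
  field
    ρ σ        : Fin n → Fin n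
    ρ³         : ∀ v → ρ (ρ (ρ v)) ≡ v
    σ²         : ∀ v → σ (σ v) ≡ v
    ~ρ         : ∀ v → Adj G v (ρ v)
    ~ρ²        : ∀ v → Adj G v (ρ (ρ v))
    ~σ         : ∀ v → Adj G v (σ v)
    neighbours : ∀ {v w} → Adj G v w → w ≡ ρ v ⊎ w ≡ ρ (ρ v) ⊎ w ≡ σ v
    σ≢ρ        : ∀ v → σ v ≢ ρ v
    σ≢ρ²       : ∀ v → σ v ≢ ρ (ρ v)

module _ (ts : List (Fin n × Fin n × Fin n)) (uniq : Unique (concatMap triVerts ts))
         (covers : ∀ u → u ∈ₗ concatMap triVerts ts) where

  next prev : Fin n → Fin n
  next u = proj₁ (∈⇒Rot ts (covers u))
  prev u = proj₁ (proj₂ (∈⇒Rot ts (covers u)))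

  isRot : ∀ u → Rot ts u (next u) (prev u)
  isRot u = proj₂ (proj₂ (∈⇒Rot ts (covers u)))

  next² : ∀ u → next (next u) ≡ prev u
  next² u = Rot-functional uniq (isRot (next u)) (rotate (isRot u))

  next³ : ∀ u → next (next (next u)) ≡ u
  next³ u = trans (cong next (next² u))
                  (Rot-functional uniq (isRot (prev u)) (rotate (rotate (isRot u))))

triangles-covering : (ts : List (Fin n × Fin n × Fin n)) → concatMap triVerts ts ↭ allFin n →
                     Unique (concatMap triVerts ts) × (∀ u → u ∈ₗ concatMap triVerts ts)
triangles-covering {n} ts perm =
  Unique-resp-↭ (setoid (Fin n)) (↭⇒↭ₛ (↭-sym perm)) (allFin⁺ n) ,
  λ u → ∈-resp-↭ (↭-sym perm) (∈-allFin u)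

rotation⇒Frame : {G : AdjFn n} → Simple G → Cubic G → (ρ : Fin n → Fin n) →
                 (∀ v → ρ (ρ (ρ v)) ≡ v) → (∀ v → Adj G v (ρ v)) → Frame G
rotation⇒Frame {n} {G} simple cubic ρ ρ³ ~ρ = record
  { ρ = ρ ; σ = σ ; ρ³ = ρ³ ; σ² = σ² ; ~ρ = ~ρ ; ~ρ² = ~ρ² ; ~σ = ~σ
  ; neighbours = neighbours ; σ≢ρ = σ≢ρ ; σ≢ρ² = σ≢ρ² }
  where
  ~ρ² : ∀ u → Adj G u (ρ (ρ u))
  ~ρ² u = Adj-sym G simple (subst (Adj G (ρ (ρ u))) (ρ³ u) (~ρ (ρ (ρ u))))

  thirds : ∀ u → Σ (Fin n) λ w → Adj G u w × w ≢ ρ u × w ≢ ρ (ρ u)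
  thirds u = third-neighbour G cubic u (ρ u) (ρ (ρ u))

  σ : Fin n → Fin n
  σ u = proj₁ (thirds u)

  ~σ : ∀ u → Adj G u (σ u)
  ~σ u = proj₁ (proj₂ (thirds u))

  σ≢ρ : ∀ u → σ u ≢ ρ u
  σ≢ρ u = proj₁ (proj₂ (proj₂ (thirds u)))

  σ≢ρ² : ∀ u → σ u ≢ ρ (ρ u)
  σ≢ρ² u = proj₂ (proj₂ (proj₂ (thirds u)))

  neighbours : ∀ {v w} → Adj G v w → w ≡ ρ v ⊎ w ≡ ρ (ρ v) ⊎ w ≡ σ v
  neighbours {v} = all-neighbours G cubic (~ρ v) (~ρ² v) (~σ v)
    (Adj⇒≢ G simple (~ρ (ρ v))) (≢-sym (σ≢ρ v)) (≢-sym (σ≢ρ² v))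

  σ² : ∀ v → σ (σ v) ≡ v
  -- `v` is a neighbour of `σ v`. Were it a rotation of `σ v`, then `σ v` would lie in the triangle
  -- of `v`, contrary to its choice as the third neighbour.
  σ² v with neighbours (Adj-sym G simple (~σ v))
  ... | inj₁ v≡ρσv         = contradiction (trans (sym (ρ³ (σ v))) (cong (ρ ∘ ρ) (sym v≡ρσv))) (σ≢ρ² v)
  ... | inj₂ (inj₁ v≡ρ²σv) = contradiction (trans (sym (ρ³ (σ v))) (cong ρ (sym v≡ρ²σv))) (σ≢ρ v)
  ... | inj₂ (inj₂ v≡σσv)  = sym v≡σσv

frame : {G : AdjFn n} → Simple G → Cubic G → HasTriangleFactor G → Frame G
frame simple cubic (ts , △s , perm) with triangles-covering ts perm
... | uniq , covers = rotation⇒Frame simple cubic (next ts uniq covers) (next³ ts uniq covers)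
                        (λ u → Rot⇒Adj simple △s (isRot ts uniq covers u))

-- Recognising the prism

lookup-injective : {A : Set} {xs : List A} → Unique xs → Injective _≡_ _≡_ (lookup xs)
lookup-injective (_ ∷ _)     {zero}  {zero}  _ = refl
lookup-injective {xs = x ∷ xs} (x∉ ∷ _) {zero}  {suc j} e =
  contradiction (subst (_∈ₗ xs) (sym e) (∈-lookup j)) (All¬⇒¬Any x∉)
lookup-injective {xs = x ∷ xs} (x∉ ∷ _) {suc i} {zero}  e =
  contradiction (subst (_∈ₗ xs) e (∈-lookup i)) (All¬⇒¬Any x∉)
lookup-injective (_ ∷ u)     {suc i} {suc j} e = cong suc (lookup-injective u e)

prism-neighbours : Fin 6 → Fin 6 × Fin 6 × Fin 6
prism-neighbours 0F = 1F , 2F , 3F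
prism-neighbours 1F = 0F , 2F , 4F
prism-neighbours 2F = 0F , 1F , 5F
prism-neighbours 3F = 4F , 5F , 0F
prism-neighbours 4F = 3F , 5F , 1F
prism-neighbours 5F = 3F , 4F , 2F

p₁ p₂ p₃ : Fin 6 → Fin 6
p₁ = proj₁ ∘ prism-neighbours
p₂ = proj₁ ∘ proj₂ ∘ prism-neighbours
p₃ = proj₂ ∘ proj₂ ∘ prism-neighbours

prism-sound : ∀ i → Adj prism i (p₁ i) × Adj prism i (p₂ i) × Adj prism i (p₃ i)
prism-sound = from-yes (all? λ i →
  adj? prism i (p₁ i) ×-dec (adj? prism i (p₂ i) ×-dec adj? prism i (p₃ i)))

prism-complete : ∀ i j → Adj prism i j → j ≡ p₁ i ⊎ j ≡ p₂ i ⊎ j ≡ p₃ i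
prism-complete = from-yes (all? λ i → all? λ j →
  adj? prism i j →-dec ((j ≟ p₁ i) ⊎-dec ((j ≟ p₂ i) ⊎-dec (j ≟ p₃ i))))

prism-distinct : ∀ i → p₁ i ≢ p₂ i × p₁ i ≢ p₃ i × p₂ i ≢ p₃ i
prism-distinct = from-yes (all? λ i →
  ¬? (p₁ i ≟ p₂ i) ×-dec (¬? (p₁ i ≟ p₃ i) ×-dec ¬? (p₂ i ≟ p₃ i)))

true-iff⇒≡ : ∀ {b c : Bool} → (b ≡ true → c ≡ true) → (c ≡ true → b ≡ true) → b ≡ c
true-iff⇒≡ {true}  {true}  _ _ = refl
true-iff⇒≡ {false} {false} _ _ = refl
true-iff⇒≡ {true}  {false} f _ = sym (f refl)
true-iff⇒≡ {false} {true}  _ g = g refl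

-- A cubic graph has no room for edges beyond those of a spanning copy of the prism, and a
-- connected one has no room for further vertices.
prism-copy⇒Isomorphic :
  {G : AdjFn n} → Cubic G → Connected G → (g : Fin 6 → Fin n) → Injective _≡_ _≡_ g →
  (∀ i → Adj G (g i) (g (p₁ i)) × Adj G (g i) (g (p₂ i)) × Adj G (g i) (g (p₃ i))) →
  Isomorphic G prism
prism-copy⇒Isomorphic {n} {G} cubic conn g g-inj edges =
  mk⤖ (f-inj , λ i → g i , λ { refl → g-inj (g∘f (g i)) }) , λ u v →
    true-iff⇒≡ (G⇒prism u v) (prism⇒G u v)
  where
  neighbour-in-copy : ∀ i {w} → Adj G (g i) w → Σ (Fin 6) λ j → Adj prism i j × g j ≡ w
  neighbour-in-copy i gi~w with edges i | prism-distinct i | prism-sound i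
  ... | e₁ , e₂ , e₃ | d₁ , d₂ , d₃ | s₁ , s₂ , s₃
      with all-neighbours G cubic e₁ e₂ e₃ (d₁ ∘ g-inj) (d₂ ∘ g-inj) (d₃ ∘ g-inj) gi~w
  ... | inj₁ e        = p₁ i , s₁ , sym e
  ... | inj₂ (inj₁ e) = p₂ i , s₂ , sym e
  ... | inj₂ (inj₂ e) = p₃ i , s₃ , sym e

  reach-in-copy : ∀ {u v} → Reach G u v → (Σ (Fin 6) λ i → g i ≡ u) → Σ (Fin 6) λ i → g i ≡ v
  reach-in-copy here i = i
  reach-in-copy (step uw r) (i , refl) with neighbour-in-copy i uw
  ... | j , _ , gj≡w = reach-in-copy r (j , gj≡w)

  preimage : ∀ v → Σ (Fin 6) λ i → g i ≡ v
  preimage v = reach-in-copy (conn (g 0F) v) (0F , refl)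

  f : Fin n → Fin 6
  f = proj₁ ∘ preimage

  g∘f : ∀ v → g (f v) ≡ v
  g∘f = proj₂ ∘ preimage

  f-inj : Injective _≡_ _≡_ f
  f-inj {u} {v} e = trans (sym (g∘f u)) (trans (cong g e) (g∘f v))

  prism⇒Adj : ∀ i j → Adj prism i j → Adj G (g i) (g j)
  prism⇒Adj i j ij with prism-complete i j ij | edges i
  ... | inj₁ refl        | e , _ , _ = e
  ... | inj₂ (inj₁ refl) | _ , e , _ = e
  ... | inj₂ (inj₂ refl) | _ , _ , e = e

  prism⇒G : ∀ u v → Adj prism (f u) (f v) → Adj G u v
  prism⇒G u v e = subst₂ (Adj G) (g∘f u) (g∘f v) (prism⇒Adj (f u) (f v) e)

  G⇒prism : ∀ u v → Adj G u v → Adj prism (f u) (f v)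
  G⇒prism u v e with neighbour-in-copy (f u) (subst (λ x → Adj G x v) (sym (g∘f u)) e)
  ... | j , fu~j , gj≡v = subst (Adj prism (f u)) (g-inj (trans gj≡v (sym (g∘f v)))) fu~j

-- Forcing along `ρ` and `σ`

module Forcing {G : AdjFn n} (simple : Simple G) (F : Frame G) where

  open Frame F
  open DecMembership (_≟_ {n}) using () renaming (_∈?_ to _∈ₗ?_)

  infix 4 _≈_

  -- Lying in a common triangle of the 2-factor.
  data _≈_ (u : Fin n) : Fin n → Set where
    0△ : u ≈ u
    1△ : u ≈ ρ u
    2△ : u ≈ ρ (ρ u)

  ≈-trans : ∀ {u v w} → u ≈ v → v ≈ w → u ≈ w
  ≈-trans         0△ q  = q
  ≈-trans         1△ 0△ = 1△
  ≈-trans         1△ 1△ = 2△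
  ≈-trans {u}     1△ 2△ = subst (u ≈_) (sym (ρ³ u)) 0△
  ≈-trans         2△ 0△ = 2△
  ≈-trans {u}     2△ 1△ = subst (u ≈_) (sym (ρ³ u)) 0△
  ≈-trans {u}     2△ 2△ = subst (u ≈_) (sym (cong ρ (ρ³ u))) 1△

  ≈-sym : ∀ {u v} → u ≈ v → v ≈ u
  ≈-sym     0△ = 0△
  ≈-sym {u} 1△ = subst (ρ u ≈_) (ρ³ u) 2△
  ≈-sym {u} 2△ = subst (ρ (ρ u) ≈_) (ρ³ u) 1△

  ≈⇒Adj : ∀ {u v} → u ≈ v → u ≢ v → Adj G u v
  ≈⇒Adj 0△ u≢u = contradiction refl u≢u
  ≈⇒Adj 1△ _   = ~ρ _
  ≈⇒Adj 2△ _   = ~ρ² _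

  ≈⇒≢σ : ∀ {u v} → u ≈ v → v ≢ σ u
  ≈⇒≢σ {u} 0△ = Adj⇒≢ G simple (~σ u)
  ≈⇒≢σ {u} 1△ = ≢-sym (σ≢ρ u)
  ≈⇒≢σ {u} 2△ = ≢-sym (σ≢ρ² u)

  u≉σu : ∀ {u} → ¬ (u ≈ σ u)
  u≉σu u≈σu = ≈⇒≢σ u≈σu refl

  σ-injective : ∀ {u v} → σ u ≡ σ v → u ≡ v
  σ-injective {u} {v} e = trans (sym (σ² u)) (trans (cong σ e) (σ² v))

  ρ≢ : ∀ {u} → u ≢ ρ u
  ρ≢ {u} = Adj⇒≢ G simple (~ρ u)

  ρ²≢ : ∀ {u} → u ≢ ρ (ρ u)
  ρ²≢ {u} = Adj⇒≢ G simple (~ρ² u)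

  module _ {S : Subset n} where

    force-σ : ∀ {u} → Colored G S u → Colored G S (ρ u) → Colored G S (ρ (ρ u)) → Colored G S (σ u)
    force-σ {u} c c₁ c₂ = force c (~σ u) others
      where
      others : ∀ w → Adj G u w → ¬ (w ≡ σ u) → Colored G S w
      others w uw w≢ with neighbours uw
      ... | inj₁ refl        = c₁
      ... | inj₂ (inj₁ refl) = c₂
      ... | inj₂ (inj₂ e)    = contradiction e w≢

    force-ρ : ∀ {u} → Colored G S u → Colored G S (ρ (ρ u)) → Colored G S (σ u) → Colored G S (ρ u)
    force-ρ {u} c c₂ cσ = force c (~ρ u) others
      where
      others : ∀ w → Adj G u w → ¬ (w ≡ ρ u) → Colored G S w
      others w uw w≢ with neighbours uw
      ... | inj₁ e           = contradiction e w≢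
      ... | inj₂ (inj₁ refl) = c₂
      ... | inj₂ (inj₂ refl) = cσ

    force-ρ² : ∀ {u} → Colored G S u → Colored G S (ρ u) → Colored G S (σ u) → Colored G S (ρ (ρ u))
    force-ρ² {u} c c₁ cσ = force c (~ρ² u) others
      where
      others : ∀ w → Adj G u w → ¬ (w ≡ ρ (ρ u)) → Colored G S w
      others w uw w≢ with neighbours uw
      ... | inj₁ refl        = c₁
      ... | inj₂ (inj₁ e)    = contradiction e w≢
      ... | inj₂ (inj₂ refl) = cσ

    -- The neighbours of `u` are `σ u` and the rest of its triangle, so once `v` and `σ u` are
    -- coloured, `u` forces whatever is left of the triangle.
    force-third : ∀ {u v w} → u ≈ v → u ≢ v → Colored G S u → Colored G S v → Colored G S (σ u) →
                  u ≈ w → Colored G S w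
    force-third 0△ u≢u _ _  _  _  = contradiction refl u≢u
    force-third _  _   c _  _  0△ = c
    force-third 1△ _   c cv _  1△ = cv
    force-third 1△ _   c cv cσ 2△ = force-ρ² c cv cσ
    force-third 2△ _   c cv cσ 1△ = force-ρ c cv cσ
    force-third 2△ _   c cv _  2△ = cv

    -- Induction on the derivation. If `u` forces `v` inside a triangle, the third vertex was
    -- already coloured, so the triangle is complete and `v` forces `σ v`. If `u` forces `v ≡ σ u`,
    -- then `σ v` is `u` itself.
    σ-closed : (∀ {s} → s ∈ S → Colored G S (σ s)) → ∀ {v} → Colored G S v → Colored G S (σ v)
    σ-closed seeds (init v∈S) = seeds v∈S
    σ-closed seeds {v} c@(force {u} cu uv cw) with neighbours uv
    ... | inj₁ refl        = force-σ c (cw (ρ v) (~ρ² u) (≢-sym ρ≢)) (subst (Colored G S) (sym (ρ³ u)) cu)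
    ... | inj₂ (inj₁ refl) = force-σ c (subst (Colored G S) (sym (ρ³ u)) cu)
                               (subst (Colored G S) (sym (cong ρ (ρ³ u))) (cw (ρ u) (~ρ u) ρ≢))
    ... | inj₂ (inj₂ refl) = subst (Colored G S) (sym (σ² u)) cu

    3-neighbours-in-S : ∀ {u p q} → u ∈ S → p ∈ S → q ∈ S → u ≢ p → u ≢ q → p ≢ q → 3 ≤ ∣ S ∣
    3-neighbours-in-S {u} {p} {q} u∈ p∈ q∈ u≢p u≢q p≢q =
      length≤∣D∣ (u ∷ p ∷ q ∷ []) ((u≢p ∷ u≢q ∷ []) ∷ (p≢q ∷ []) ∷ [] ∷ []) (u∈ ∷ p∈ ∷ q∈ ∷ [])

    -- The first force needs a seed all of whose neighbours but one are seeds.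
    Colored⇒∈⊎3≤ : ∀ {v} → Colored G S v → v ∈ S ⊎ 3 ≤ ∣ S ∣
    Colored⇒∈⊎3≤ (init v∈S) = inj₁ v∈S
    Colored⇒∈⊎3≤ {v} (force {u} cu uv cw) with Colored⇒∈⊎3≤ cu
    ... | inj₂ 3≤  = inj₂ 3≤
    ... | inj₁ u∈S with neighbours uv
    ... | inj₁ refl with Colored⇒∈⊎3≤ (cw (ρ (ρ u)) (~ρ² u) (≢-sym ρ≢))
                       | Colored⇒∈⊎3≤ (cw (σ u) (~σ u) (σ≢ρ u))
    ... | inj₂ 3≤ | _       = inj₂ 3≤
    ... | inj₁ _  | inj₂ 3≤ = inj₂ 3≤
    ... | inj₁ p∈ | inj₁ q∈ =
          inj₂ (3-neighbours-in-S u∈S p∈ q∈ ρ²≢ (≈⇒≢σ 0△) (≢-sym (σ≢ρ² u)))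
    Colored⇒∈⊎3≤ {v} (force {u} cu uv cw) | inj₁ u∈S | inj₂ (inj₁ refl)
      with Colored⇒∈⊎3≤ (cw (ρ u) (~ρ u) ρ≢) | Colored⇒∈⊎3≤ (cw (σ u) (~σ u) (σ≢ρ² u))
    ... | inj₂ 3≤ | _       = inj₂ 3≤
    ... | inj₁ _  | inj₂ 3≤ = inj₂ 3≤
    ... | inj₁ p∈ | inj₁ q∈ =
          inj₂ (3-neighbours-in-S u∈S p∈ q∈ ρ≢ (≈⇒≢σ 0△) (≢-sym (σ≢ρ u)))
    Colored⇒∈⊎3≤ {v} (force {u} cu uv cw) | inj₁ u∈S | inj₂ (inj₂ refl)
      with Colored⇒∈⊎3≤ (cw (ρ u) (~ρ u) (≢-sym (σ≢ρ u)))
         | Colored⇒∈⊎3≤ (cw (ρ (ρ u)) (~ρ² u) (≢-sym (σ≢ρ² u)))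
    ... | inj₂ 3≤ | _       = inj₂ 3≤
    ... | inj₁ _  | inj₂ 3≤ = inj₂ 3≤
    ... | inj₁ p∈ | inj₁ q∈ = inj₂ (3-neighbours-in-S u∈S p∈ q∈ ρ≢ ρ²≢ ρ≢)

    -- Either colouring some vertex of the triangle of `x` involves a force, which already needs
    -- three seeds, or the triangle itself consists of three seeds.
    3≤∣forcing∣ : IsForcingSet G S → Fin n → 3 ≤ ∣ S ∣
    3≤∣forcing∣ forcing x
      with Colored⇒∈⊎3≤ (forcing x) | Colored⇒∈⊎3≤ (forcing (ρ x)) | Colored⇒∈⊎3≤ (forcing (ρ (ρ x)))
    ... | inj₂ 3≤ | _       | _       = 3≤
    ... | inj₁ _  | inj₂ 3≤ | _       = 3≤
    ... | inj₁ _  | inj₁ _  | inj₂ 3≤ = 3≤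
    ... | inj₁ a  | inj₁ b  | inj₁ c  = 3-neighbours-in-S a b c ρ≢ ρ²≢ ρ≢

  -- Seed lists with coloured partners

  Col : List (Fin n) → Fin n → Set
  Col l = Colored G (fromList l)

  C : List (Fin n) → Subset n
  C l = proj₁ (closure G (fromList l))

  ∈C⇒Col : ∀ l {v} → v ∈ C l → Col l v
  ∈C⇒Col l = proj₁ (proj₂ (closure G (fromList l)))

  Col⇒∈C : ∀ l {v} → Col l v → v ∈ C l
  Col⇒∈C l = proj₂ (proj₂ (closure G (fromList l)))

  col? : ∀ l v → Dec (Col l v)
  col? l = colored? G (fromList l)

  seed : ∀ l {v} → v ∈ₗ l → Col l v
  seed l v∈ = init (∈-fromList⁺ l v∈)

  seeds⊆⇒Col⊆ : ∀ l l′ → All (Col l′) l → ∀ {v} → Col l v → Col l′ v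
  seeds⊆⇒Col⊆ l l′ cs = Colored-mono G (λ v∈ → All.lookup cs (∈-fromList⁻ l v∈))

  -- Requiring the partner σ s of every seed to be coloured makes the coloured set a union of
  -- pairs {v , σ v}, so that every two vertices added in a triangle colour four.
  record Good (l : List (Fin n)) : Set where
    field
      total    : All (λ v → Σ (Fin n) λ u → u ∈ₗ l × Adj G v u) l
      partners : All (λ v → Col l (σ v)) l

  Col-σ : ∀ {l} → Good l → ∀ {v} → Col l v → Col l (σ v)
  Col-σ {l} good = σ-closed (λ s∈ → All.lookup (Good.partners good) (∈-fromList⁻ l s∈))

  Col-third : ∀ {l} → Good l → ∀ {u v w} → u ≈ v → u ≢ v → Col l u → Col l v → u ≈ w → Col l w
  Col-third good u≈v u≢v cu cv = force-third u≈v u≢v cu cv (Col-σ good cu)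

  Good⇒IsTotal : ∀ {l} → Good l → IsTotal G (fromList l)
  Good⇒IsTotal {l} good v v∈ with All.lookup (Good.total good) (∈-fromList⁻ l v∈)
  ... | u , u∈ , vu = u , ∈-fromList⁺ l u∈ , vu

  -- Both coloured sets are `σ`-closed, so `σ v` and `σ (ρ v)` are new together with `v` and `ρ v`,
  -- and these four are distinct. The list `xs` accounts for further new vertices.
  growth : ∀ {l} l′ → Good l → Good l′ → (∀ {v} → Col l v → Col l′ v) → ∀ {v} →
           ¬ Col l v → ¬ Col l (ρ v) → Col l′ v → Col l′ (ρ v) →
           (xs : List (Fin n)) → Unique xs → All (Col l′) xs → All (¬_ ∘ Col l) xs →
           All (_∉ₗ v ∷ ρ v ∷ σ v ∷ σ (ρ v) ∷ []) xs →
           ∣ C l ∣ + (4 + length xs) ≤ ∣ C l′ ∣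
  growth {l} l′ good good′ l⊆l′ {v} ¬cv ¬cρv cv cρv xs uniq cxs ¬cxs new =
    ∣C∣+length≤∣D∣ (v ∷ ρ v ∷ σ v ∷ σ (ρ v) ∷ xs)
      ( (ρ≢ ∷ ≈⇒≢σ 0△ ∷ ≈⇒≢σ (≈-sym 1△) ∷ apart here₀)
      ∷ (≈⇒≢σ 1△ ∷ ≈⇒≢σ 0△ ∷ apart here₁)
      ∷ ((λ e → ρ≢ (σ-injective e)) ∷ apart here₂)
      ∷ apart here₃
      ∷ uniq)
      (λ x∈ → Col⇒∈C l′ (l⊆l′ (∈C⇒Col l x∈)))
      (Col⇒∈C l′ cv ∷ Col⇒∈C l′ cρv ∷ Col⇒∈C l′ (Col-σ good′ cv) ∷ Col⇒∈C l′ (Col-σ good′ cρv)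
        ∷ All.map (Col⇒∈C l′) cxs)
      (¬cv ∘ ∈C⇒Col l ∷ ¬cρv ∘ ∈C⇒Col l ∷ ¬cv ∘ unσ ∘ ∈C⇒Col l ∷ ¬cρv ∘ unσ ∘ ∈C⇒Col l
        ∷ All.map (_∘ ∈C⇒Col l) ¬cxs)
    where
    unσ : ∀ {u} → Col l (σ u) → Col l u
    unσ {u} c = subst (Col l) (σ² u) (Col-σ good c)
    here₀ = here refl
    here₁ = there (here refl)
    here₂ = there (there (here refl))
    here₃ = there (there (there (here refl)))
    apart : ∀ {y} → y ∈ₗ v ∷ ρ v ∷ σ v ∷ σ (ρ v) ∷ [] → All (y ≢_) xs
    apart y∈ = All.map (λ x∉ y≡x → x∉ (subst (_∈ₗ _) y≡x y∈)) new

  growth₄ : ∀ {l} l′ → Good l → Good l′ → (∀ {v} → Col l v → Col l′ v) → ∀ {v} →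
            ¬ Col l v → ¬ Col l (ρ v) → Col l′ v → Col l′ (ρ v) → ∣ C l ∣ + 4 ≤ ∣ C l′ ∣
  growth₄ l′ good good′ l⊆l′ ¬cv ¬cρv cv cρv =
    growth l′ good good′ l⊆l′ ¬cv ¬cρv cv cρv [] [] [] [] []

  -- The two new seeds are adjacent, which keeps the set total. With `u` already coloured they
  -- complete its triangle, so each forces its partner.
  Good-seed² : ∀ {l} u → Good l → Col l u → Good (ρ u ∷ ρ (ρ u) ∷ l)
  Good-seed² {l} u good cu = record
    { total = (ρ (ρ u) , there (here refl) , ~ρ (ρ u))
            ∷ (ρ u , here refl , Adj-sym G simple (~ρ (ρ u)))
            ∷ All.map (λ { (v , v∈ , uv) → v , there (there v∈) , uv }) (Good.total good)
    ; partners = force-σ c₁ c₂ (back c₀)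
               ∷ force-σ c₂ (back c₀) (subst (Col l⁺) (sym (cong ρ (ρ³ u))) c₁)
               ∷ All.map old (Good.partners good) }
    where
    l⁺ : List (Fin n)
    l⁺ = ρ u ∷ ρ (ρ u) ∷ l
    old : ∀ {v} → Col l v → Col l⁺ v
    old = seeds⊆⇒Col⊆ l l⁺ (All.tabulate (λ v∈ → seed l⁺ (there (there v∈))))
    c₀ = old cu
    c₁ = seed l⁺ (here refl)
    c₂ = seed l⁺ (there (here refl))
    back : Col l⁺ u → Col l⁺ (ρ (ρ (ρ u)))
    back = subst (Col l⁺) (sym (ρ³ u))

  Col-seed² : ∀ l u {v} → Col l v → Col (ρ u ∷ ρ (ρ u) ∷ l) v
  Col-seed² l u = seeds⊆⇒Col⊆ l l⁺ (All.tabulate (λ v∈ → seed l⁺ (there (there v∈))))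
    where
    l⁺ : List (Fin n)
    l⁺ = ρ u ∷ ρ (ρ u) ∷ l

  growth-seed² : ∀ {l} u → Good l → Col l u → ¬ Col l (ρ u) → ¬ Col l (ρ (ρ u)) →
                 ∣ C l ∣ + 4 ≤ ∣ C (ρ u ∷ ρ (ρ u) ∷ l) ∣
  growth-seed² {l} u good cu ¬c₁ ¬c₂ =
    growth₄ l⁺ good (Good-seed² u good cu) (Col-seed² l u) ¬c₁ ¬c₂
      (seed l⁺ (here refl)) (seed l⁺ (there (here refl)))
    where
    l⁺ : List (Fin n)
    l⁺ = ρ u ∷ ρ (ρ u) ∷ l

  -- Extending to a total forcing set

  module _ (conn : Connected G) where

    -- By connectedness some edge leaves the coloured set. It is not a `σ`-edge, as the set is
    -- `σ`-closed, so it lies in a triangle; a second coloured vertex there would force the third.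
    one-colored : ∀ l → Good l → ∀ {x y} → Col l x → ¬ Col l y →
                  Σ (Fin n) λ u → Col l u × ¬ Col l (ρ u) × ¬ Col l (ρ (ρ u))
    one-colored l good {x} {y} cx ¬cy with Reach-exit G (col? l) (conn x y) cx ¬cy
    ... | u , v , cu , ¬cv , uv with neighbours uv
    ... | inj₁ refl        = u , cu , ¬cv , λ c₂ → ¬cv (Col-third good 2△ ρ²≢ cu c₂ 1△)
    ... | inj₂ (inj₁ refl) = u , cu , (λ c₁ → ¬cv (Col-third good 1△ ρ≢ cu c₁ 2△)) , ¬cv
    ... | inj₂ (inj₂ refl) = contradiction (Col-σ good cu) ¬cv

    -- The bound says, without subtraction, that the added seeds number at most half of the vertices
    -- not yet coloured: each round adds two seeds and colours at least four vertices.
    extend : ∀ l → Good l → ∀ {x} → Col l x → Acc _⊃_ (C l) →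
             Σ (List (Fin n)) λ l′ → IsTotalForcingSet G (fromList l′) ×
               2 * length l′ + ∣ C l ∣ ≤ n + 2 * length l
    extend l good {x} cx (acc rec) with any? (λ v → ¬? (col? l v))
    ... | no all-col = l , ((λ v → decidable-stable (col? l v) (λ ¬cv → all-col (v , ¬cv))) , Good⇒IsTotal good)
                     , ≤-trans (+-monoʳ-≤ (2 * length l) (∣p∣≤n (C l))) (≤-reflexive (+-comm _ n))
    ... | yes (y , ¬cy) with one-colored l good cx ¬cy
    ... | u , cu , ¬c₁ , ¬c₂ with extend l⁺ good⁺ (Col-seed² l u cx) (rec C⊂C⁺)
      where
      l⁺ : List (Fin n)
      l⁺ = ρ u ∷ ρ (ρ u) ∷ l
      good⁺ : Good l⁺
      good⁺ = Good-seed² u good cu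
      C⊂C⁺ : C l ⊂ C l⁺
      C⊂C⁺ = (λ v∈ → Col⇒∈C l⁺ (Col-seed² l u (∈C⇒Col l v∈)))
           , ρ u , Col⇒∈C l⁺ (seed l⁺ (here refl)) , ¬c₁ ∘ ∈C⇒Col l
    -- The cancelled 4 is on the left the growth of the coloured set, on the right twice the number
    -- of new seeds.
    ... | l′ , tfs , bound = l′ , tfs , +-cancelʳ-≤ 4 _ _ (begin
          2 * length l′ + ∣ C l ∣ + 4                       ≡⟨ +-assoc (2 * length l′) _ _ ⟩
          2 * length l′ + (∣ C l ∣ + 4)                     ≤⟨ +-monoʳ-≤ (2 * length l′) (growth-seed² u good cu ¬c₁ ¬c₂) ⟩
          2 * length l′ + ∣ C (ρ u ∷ ρ (ρ u) ∷ l) ∣         ≤⟨ bound ⟩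
          n + 2 * (2 + length l)                            ≡⟨ cong (n +_) (*-distribˡ-+ 2 2 (length l)) ⟩
          n + (4 + 2 * length l)                            ≡⟨ cong (n +_) (+-comm 4 (2 * length l)) ⟩
          n + (2 * length l + 4)                            ≡⟨ +-assoc n _ _ ⟨
          n + 2 * length l + 4                              ∎)
      where open ≤-Reasoning

  -- A single triangle as seed list

  other : ∀ {u v} → u ≈ v → u ≢ v → Σ (Fin n) λ t → u ≈ t × v ≈ t × t ≢ u × t ≢ v
  other     0△ u≢u = contradiction refl u≢u
  other {u} 1△ _   = ρ (ρ u) , 2△ , 1△ , ≢-sym ρ²≢ , ≢-sym ρ≢
  other {u} 2△ _   = ρ u , 1△ , ≈-trans (≈-sym 2△) 1△ , ≢-sym ρ≢ , ρ≢

  triangle : Fin n → List (Fin n)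
  triangle x = x ∷ ρ x ∷ ρ (ρ x) ∷ []

  -- Listed in the vertex order of `prism`, so that `lookup` can serve as the embedding of the
  -- prism.
  triangle+σ : Fin n → List (Fin n)
  triangle+σ x = x ∷ ρ x ∷ ρ (ρ x) ∷ σ x ∷ σ (ρ x) ∷ σ (ρ (ρ x)) ∷ []

  triangle+σ-unique : ∀ x → Unique (triangle+σ x)
  triangle+σ-unique x =
      (ρ≢ ∷ ρ²≢ ∷ ≈⇒≢σ 0△ ∷ ≈⇒≢σ (≈-sym 1△) ∷ ≈⇒≢σ (≈-sym 2△) ∷ [])
    ∷ (ρ≢ ∷ ≈⇒≢σ 1△ ∷ ≈⇒≢σ 0△ ∷ ≈⇒≢σ (≈-sym 1△) ∷ [])
    ∷ (≈⇒≢σ 2△ ∷ ≈⇒≢σ 1△ ∷ ≈⇒≢σ 0△ ∷ [])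
    ∷ (ρ≢ ∘ σ-injective ∷ ρ²≢ ∘ σ-injective ∷ [])
    ∷ (ρ≢ ∘ σ-injective ∷ [])
    ∷ [] ∷ []

  Good-triangle : ∀ x → Good (triangle x)
  Good-triangle x = record
    { total = (ρ x , there (here refl) , ~ρ x)
            ∷ (x , here refl , Adj-sym G simple (~ρ x))
            ∷ (x , here refl , Adj-sym G simple (~ρ² x)) ∷ []
    ; partners = force-σ c₀ c₁ c₂
               ∷ force-σ c₁ c₂ (subst c (sym (ρ³ x)) c₀)
               ∷ force-σ c₂ (subst c (sym (ρ³ x)) c₀) (subst c (sym (cong ρ (ρ³ x))) c₁) ∷ [] }
    where
    c = Col (triangle x)
    c₀ = seed (triangle x) (here refl)
    c₁ = seed (triangle x) (there (here refl))
    c₂ = seed (triangle x) (there (there (here refl)))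

  Col-triangle+σ : ∀ x → All (Col (triangle x)) (triangle+σ x)
  Col-triangle+σ x with All.tabulate (seed (triangle x))
  ... | c₀ ∷ c₁ ∷ c₂ ∷ [] =
        c₀ ∷ c₁ ∷ c₂ ∷ Col-σ good c₀ ∷ Col-σ good c₁ ∷ Col-σ good c₂ ∷ []
    where good = Good-triangle x

  6≤∣C-triangle∣ : ∀ x → 6 ≤ ∣ C (triangle x) ∣
  6≤∣C-triangle∣ x = length≤∣D∣ (triangle+σ x) (triangle+σ-unique x)
    (All.map (Col⇒∈C (triangle x)) (Col-triangle+σ x))

  -- The case of equality

  -- `bound` is the form in which equality is used: a good list colouring more than twice its length
  -- would extend to a total forcing set of fewer than `n / 2` vertices.
  module Extremal (cubic : Cubic G) (conn : Connected G)
                  (bound : ∀ {x} l → x ∈ₗ l → Good l → ∣ C l ∣ ≤ 2 * length l) where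

    -- A seventh coloured vertex would exceed twice the three seeds.
    Col-triangle⇒∈ : ∀ x {t} → Col (triangle x) t → t ∈ₗ triangle+σ x
    Col-triangle⇒∈ x {t} ct with t ∈ₗ? triangle+σ x
    ... | yes t∈ = t∈
    ... | no  t∉ = contradiction
          (≤-trans
            (length≤∣D∣ (t ∷ triangle+σ x) (¬Any⇒All¬ _ t∉ ∷ triangle+σ-unique x)
              (All.map (Col⇒∈C (triangle x)) (ct ∷ Col-triangle+σ x)))
            (bound (triangle x) (here refl) (Good-triangle x)))
          (<-irrefl refl)

    -- The third vertex `t` of the triangle through `σ x` and `σ (ρ x)` is forced, hence among the
    -- six. It is not in the triangle of `x`, for then `σ x` would be too. So `t` is `σ (ρ (ρ x))`,
    -- and the six vertices span a prism.
    linked⇒prism : ∀ x → σ x ≈ σ (ρ x) → Isomorphic G prism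
    linked⇒prism x a≈b with other a≈b (ρ≢ ∘ σ-injective)
    ... | t , a≈t , b≈t , t≢a , t≢b = finish (Col-triangle⇒∈ x ct)
      where
      ct : Col (triangle x) t
      ct with Col-triangle+σ x
      ... | _ ∷ _ ∷ _ ∷ ca ∷ cb ∷ _ ∷ [] = Col-third (Good-triangle x) a≈b (ρ≢ ∘ σ-injective) ca cb a≈t

      σx≉ : ∀ {u} → x ≈ u → u ≡ t → Isomorphic G prism
      σx≉ x≈u refl = contradiction (≈-trans x≈u (≈-sym a≈t)) u≉σu

      finish : t ∈ₗ triangle+σ x → Isomorphic G prism
      finish (here e)                                         = σx≉ 0△ (sym e)
      finish (there (here e))                                 = σx≉ 1△ (sym e)
      finish (there (there (here e)))                         = σx≉ 2△ (sym e)
      finish (there (there (there (here e))))                 = contradiction e t≢a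
      finish (there (there (there (there (here e)))))         = contradiction e t≢b
      finish (there (there (there (there (there (here refl)))))) =
        prism-copy⇒Isomorphic cubic conn (lookup (triangle+σ x)) (lookup-injective (triangle+σ-unique x)) edges
        where
        ~sym : ∀ {u v} → Adj G u v → Adj G v u
        ~sym = Adj-sym G simple
        ab = ≈⇒Adj a≈b (ρ≢ ∘ σ-injective)
        at = ≈⇒Adj a≈t (ρ²≢ ∘ σ-injective)
        bt = ≈⇒Adj b≈t (ρ≢ ∘ σ-injective)
        g : Fin 6 → Fin n
        g = lookup (triangle+σ x)
        edges : ∀ i → Adj G (g i) (g (p₁ i)) × Adj G (g i) (g (p₂ i)) × Adj G (g i) (g (p₃ i))
        edges 0F = ~ρ x , ~ρ² x , ~σ x
        edges 1F = ~sym (~ρ x) , ~ρ (ρ x) , ~σ (ρ x)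
        edges 2F = ~sym (~ρ² x) , ~sym (~ρ (ρ x)) , ~σ (ρ (ρ x))
        edges 3F = ab , at , ~sym (~σ x)
        edges 4F = ~sym ab , bt , ~sym (~σ (ρ x))
        edges 5F = ~sym at , ~sym bt , ~sym (~σ (ρ (ρ x)))

    module _ (x : Fin n) where

      l₀ l₁ l₂ : List (Fin n)
      x′ v w y : Fin n
      l₀ = triangle x
      x′ = σ x
      v = ρ x′
      w = ρ (ρ x′)
      y = σ v
      l₁ = v ∷ w ∷ l₀
      l₂ = y ∷ ρ y ∷ v ∷ l₀

      good₀ : Good l₀
      good₀ = Good-triangle x

      cx′ : Col l₀ x′
      cx′ = Col-σ good₀ (seed l₀ (here refl))

      good₁ : Good l₁
      good₁ = Good-seed² x′ good₀ cx′

      l₀⊆l₁ : ∀ {u} → Col l₀ u → Col l₁ u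
      l₀⊆l₁ = Col-seed² l₀ x′

      -- `v` is one of the six vertices, but neither `σ x` nor in the triangle of `x`. So it is the
      -- partner of another vertex of that triangle, and two edges join the two triangles.
      Col-v⇒prism : Col l₀ v → Isomorphic G prism
      Col-v⇒prism cv = finish (Col-triangle⇒∈ x cv)
        where
        on-triangle : ∀ {u} → x ≈ u → v ≡ u → Isomorphic G prism
        on-triangle {u} x≈u v≡u =
          contradiction (≈-trans x≈u (≈-sym (subst (x′ ≈_) v≡u 1△))) u≉σu

        finish : v ∈ₗ triangle+σ x → Isomorphic G prism
        finish (here e)                                 = on-triangle 0△ e
        finish (there (here e))                         = on-triangle 1△ e
        finish (there (there (here e)))                 = on-triangle 2△ e
        finish (there (there (there (here e))))         = contradiction (sym e) ρ≢
        finish (there (there (there (there (here e))))) = linked⇒prism x (subst (x′ ≈_) e 1△)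
        -- Rotating the base point to `ρ (ρ x)`, whose successor is `x`, gives the linked pair the
        -- required form.
        finish (there (there (there (there (there (here e)))))) =
          linked⇒prism (ρ (ρ x)) (subst (λ z → σ (ρ (ρ x)) ≈ σ z) (sym (ρ³ x)) (≈-sym (subst (x′ ≈_) e 1△)))

      module _ (¬cv : ¬ Col l₀ v) where

        ¬cw : ¬ Col l₀ w
        ¬cw cw = ¬cv (Col-third good₀ 2△ ρ²≢ cx′ cw 1△)

        ∣C₁∣≤10 : ∣ C l₁ ∣ ≤ 10
        ∣C₁∣≤10 = bound l₁ (here refl) good₁

        10≤∣C₁∣ : 10 ≤ ∣ C l₁ ∣
        10≤∣C₁∣ = ≤-trans (+-monoˡ-≤ 4 (6≤∣C-triangle∣ x)) (growth-seed² x′ good₀ cx′ ¬cv ¬cw)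

        -- A vertex `t` not coloured from `l₀` must be one of the four new vertices
        -- `v , w , y , σ w`. Of these `v` and `w` lie outside the triangle of `σ v`, and `t ≡ σ w`
        -- would link the triangles of `v` and `y` by two edges.
        Col₁⇒Col₀ : ∀ {t} → y ≈ t → t ≢ y → Col l₁ t → Col l₀ t ⊎ Isomorphic G prism
        Col₁⇒Col₀ {t} y≈t t≢y ct with col? l₀ t | t ∈ₗ? v ∷ w ∷ y ∷ σ w ∷ []
        ... | yes c | _ = inj₁ c
        ... | no _  | yes (here refl)                         = contradiction (≈-sym y≈t) u≉σu
        ... | no _  | yes (there (here refl))                 = contradiction (≈-sym (≈-trans y≈t (≈-sym 1△))) u≉σu
        ... | no _  | yes (there (there (here e)))            = contradiction e t≢y
        ... | no _  | yes (there (there (there (here refl)))) = inj₂ (linked⇒prism v y≈t)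
        -- Otherwise `t` is a fifth new vertex, and five seeds colour `6 + 5` vertices.
        ... | no ¬c | no t∉ = contradiction
              (≤-trans (≤-trans (+-monoˡ-≤ 5 (6≤∣C-triangle∣ x))
                (growth l₁ good₀ good₁ l₀⊆l₁ ¬cv ¬cw (seed l₁ (here refl)) (seed l₁ (there (here refl)))
                  (t ∷ []) ([] ∷ []) (ct ∷ []) (¬c ∷ []) (t∉ ∷ [])))
                ∣C₁∣≤10)
              (<-irrefl refl)

        cy₁ : Col l₁ y
        cy₁ = Col-σ good₁ (seed l₁ (here refl))

        -- `ρ y` forces the rest of its triangle to be coloured from `l₁`. If both `ρ y` and
        -- `ρ (ρ y)` are already coloured from `l₀`, then so are `y` and its partner `v`, against
        -- `¬cv`.
        Col-ρy⇒prism : Col l₁ (ρ y) → Isomorphic G prism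
        Col-ρy⇒prism c₁ with Col₁⇒Col₀ 1△ (≢-sym ρ≢) c₁
                           | Col₁⇒Col₀ 2△ (≢-sym ρ²≢) (Col-third good₁ 1△ ρ≢ cy₁ c₁ 2△)
        ... | inj₂ iso | _        = iso
        ... | inj₁ _   | inj₂ iso = iso
        ... | inj₁ a   | inj₁ b   = contradiction
              (subst (Col l₀) (σ² v) (Col-σ good₀ (Col-third good₀ 1△ ρ≢ a b (≈-sym 1△)))) ¬cv

        -- The path v , y , ρ y colours two further triangles at the cost of three seeds.
        c₂ : ∀ {z} → z ∈ₗ l₂ → Col l₂ z
        c₂ = seed l₂

        cy₂ : Col l₂ y
        cy₂ = c₂ (here refl)

        cv₂ : Col l₂ v
        cv₂ = c₂ (there (there (here refl)))

        l₀⊆l₂ : ∀ {u} → Col l₀ u → Col l₂ u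
        l₀⊆l₂ = seeds⊆⇒Col⊆ l₀ l₂ (All.tabulate (λ v∈ → c₂ (there (there (there v∈)))))

        good₂ : Good l₂
        good₂ = record
          { total = (ρ y , there (here refl) , ~ρ y)
                  ∷ (y , here refl , Adj-sym G simple (~ρ y))
                  ∷ (y , here refl , ~σ v)
                  ∷ All.map (λ { (v , v∈ , uv) → v , there (there (there v∈)) , uv }) (Good.total good₀)
          ; partners = σy
                     -- `y` forces `ρ (ρ y)`, its other neighbours `ρ y` and `σ y ≡ v` being seeds;
                     -- the triangle is then complete and `ρ y` forces its partner.
                     ∷ force-σ (c₂ (there (here refl))) (force-ρ² cy₂ (c₂ (there (here refl))) σy)
                         (subst (Col l₂) (sym (ρ³ y)) cy₂)
                     ∷ cy₂
                     ∷ All.map l₀⊆l₂ (Good.partners good₀) }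
          where
          σy : Col l₂ (σ y)
          σy = subst (Col l₂) (sym (σ² v)) cv₂

        -- Only `w` is listed in `l₁` and not in `l₂`; it is the third vertex of a triangle in which
        -- `x′` and `v` are coloured.
        l₁⊆l₂ : ∀ {u} → Col l₁ u → Col l₂ u
        l₁⊆l₂ = seeds⊆⇒Col⊆ l₁ l₂
          ( cv₂ ∷ Col-third good₂ 1△ ρ≢ (l₀⊆l₂ cx′) cv₂ 2△
          ∷ All.tabulate (λ v∈ → c₂ (there (there (there v∈)))))

        -- If `ρ y` is not coloured from `l₁`, neither is `ρ (ρ y)`, since `y` is. Both are coloured
        -- from `l₂`, which then colours at least `10 + 4` vertices, while its six seeds allow only
        -- 12.
        ρy-colored : ¬ ¬ Col l₁ (ρ y)
        ρy-colored ¬c₁ = contradiction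
          (≤-trans
            (≤-trans (+-monoˡ-≤ 4 10≤∣C₁∣)
              (growth₄ l₂ good₁ good₂ l₁⊆l₂ ¬c₁
                (λ c → ¬c₁ (Col-third good₁ 2△ ρ²≢ cy₁ c 1△))
                (c₂ (there (here refl)))
                (Col-third good₂ 1△ ρ≢ cy₂ (c₂ (there (here refl))) 2△)))
            (bound l₂ (here refl) good₂))
          λ 14≤12 → <⇒≱ (s≤s (n≤1+n 12)) 14≤12

      extremal⇒prism : Isomorphic G prism
      extremal⇒prism with col? l₀ v
      ... | yes cv = Col-v⇒prism cv
      ... | no ¬cv with col? l₁ (ρ y)
      ... | yes c = Col-ρy⇒prism ¬cv c
      ... | no ¬c = contradiction ¬c (ρy-colored ¬cv)

-- The bound and its equality case

Ft-bound : {G : AdjFn n} → Fin n → Simple G → Cubic G → Connected G → Frame G →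
           Σ ℕ λ k → IsFt G k × (2 * k ≤ n) × ((2 * k ≡ n) ⇔ Isomorphic G prism)
Ft-bound {n} {G} x simple cubic conn F = from-minimum (smallest (isTotalForcingSet? G) initial)
  where
  open Forcing simple F

  initial : ∃ (IsTotalForcingSet G)
  initial with extend conn (triangle x) (Good-triangle x) (seed (triangle x) (here refl)) (⊃-wellFounded _)
  ... | l , tfs , _ = fromList l , tfs

  from-minimum : (Σ ℕ (IsFt G)) →
                 Σ ℕ λ k → IsFt G k × (2 * k ≤ n) × ((2 * k ≡ n) ⇔ Isomorphic G prism)
  from-minimum (k , minimum@((S , (forcing , _) , ∣S∣≡k) , least)) =
    k , minimum , 2k≤n , mk⇔ extremal prism⇒2k≡n
    where
    -- Minimality of `k` applied to the total forcing set that extends `l`.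
    2k+∣C∣≤ : ∀ {x} l → x ∈ₗ l → Good l → 2 * k + ∣ C l ∣ ≤ n + 2 * length l
    2k+∣C∣≤ l x∈ good with extend conn l good (seed l x∈) (⊃-wellFounded _)
    ... | l′ , tfs , bound =
          ≤-trans (+-monoˡ-≤ ∣ C l ∣ (*-monoʳ-≤ 2 (≤-trans (least _ tfs) (∣fromList∣≤length l′)))) bound

    2k≤n : 2 * k ≤ n
    -- The six vertices coloured by a triangle balance twice its three seeds.
    2k≤n = +-cancelʳ-≤ 6 _ _ (≤-trans (+-monoʳ-≤ (2 * k) (6≤∣C-triangle∣ x))
                                      (2k+∣C∣≤ (triangle x) (here refl) (Good-triangle x)))

    extremal : 2 * k ≡ n → Isomorphic G prism
    extremal 2k≡n = Extremal.extremal⇒prism cubic conn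
      (λ l x∈ good → +-cancelˡ-≤ n _ _ (subst (λ m → m + ∣ C l ∣ ≤ n + 2 * length l) 2k≡n (2k+∣C∣≤ l x∈ good)))
      x

    prism⇒2k≡n : Isomorphic G prism → 2 * k ≡ n
    -- The isomorphism gives `n ≤ 6`, and a forcing set has at least three vertices, so `6 ≤ 2 * k`.
    prism⇒2k≡n (f , _) = ≤-antisym 2k≤n (≤-trans (injective⇒≤ (Bijection.injective f))
      (*-monoʳ-≤ 2 (subst (3 ≤_) ∣S∣≡k (3≤∣forcing∣ forcing x))))

theorem1 : (n : ℕ) (G : AdjFn n) → 0 < n → Simple G → Cubic G → Connected G →
    HasTriangleFactor G →
    Σ ℕ λ k → IsFt G k × (2 * k ≤ n) × ((2 * k ≡ n) ⇔ Isomorphic G prism)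
theorem1 (suc _) G _ simple cubic conn factor =
  Ft-bound zero simple cubic conn (frame simple cubic factor)
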